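{- Let $k$ be a positive integer and let $\mathcal{A}$ be a monotone family of subsets of $[n]$ with all minterms of size at most $k$. Then for every $p\in[0,1]$, $$\mu_{p/2}(\mathcal{A})\ \ge\ \frac{1}{k2^{3k-1}}\,\mu_p(\mathcal{A}).$$
   Context: Let $[n]=\{0,1,\ldots,n\}$. For $p\in[0,1]$, $\mu_p(\mathcal{A})$ is the probability that a random subset of $[n]$, containing each element independently with probability $p$, belongs to $\mathcal{A}$. A family $\mathcal{A}$ is monotone if $A\in\mathcal{A}$ and $A\subset B\subseteq [n]$ imply $B\in\mathcal{A}$. A minterm of $\mathcal{A}$ is a member of $\mathcal{A}$ that is minimal with respect to inclusion. -}

module Defs where

open import Data.Fin.Subset using (Subset; inside; outside; _⊆_)
open import Data.Integer.Base using (1ℤ)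
open import Data.List.Base using (List; [_]; _++_; map; filter; foldr)
open import Data.Nat.Base as ℕ using (ℕ; zero; suc; NonZero)
import Data.Nat.Properties as ℕ
open import Data.Product.Base using (_×_; _,_; ∃)
open import Data.Rational.Base as ℚ using (ℚ; 0ℚ; 1ℚ; ½)
import Data.Rational.Properties as ℚ
open import Data.Rational.Solver using (module +-*-Solver)
open import Data.Vec.Base using ([]; _∷_)
open import Function.Base using (it)
open import Relation.Binary.Definitions using (_Respects_)
open import Relation.Binary.PropositionalEquality
  using (_≡_; refl; sym; trans; cong; subst)
open import Relation.Unary using (Pred; Decidable)

-- Real numbers are represented by Cauchy sequences of rationals.  Two
-- sequences x and y represent the same real when x ≤ y and y ≤ x for the order
-- defined below, so no quotient is taken.

Cauchy : (ℕ → ℚ) → Set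
Cauchy x = ∀ ε → 0ℚ ℚ.< ε →
  ∃ λ N → ∀ m n → N ℕ.≤ m → N ℕ.≤ n → ℚ.∣ x m ℚ.- x n ∣ ℚ.< ε

record ℝ : Set where
  constructor mkℝ
  field
    seq    : ℕ → ℚ
    cauchy : Cauchy seq

open ℝ public

private
  ½-pos : ∀ {ε} → 0ℚ ℚ.< ε → 0ℚ ℚ.< ½ ℚ.* ε
  ½-pos = ℚ.*-monoʳ-<-pos ½

  halves : ∀ ε → ½ ℚ.* ε ℚ.+ ½ ℚ.* ε ≡ ε
  halves = solve 1 (λ e → con ½ :* e :+ con ½ :* e := e) refl
    where open +-*-Solver

  const-cauchy : ∀ q → Cauchy (λ _ → q)
  const-cauchy q ε 0<ε =
    0 , λ _ _ _ _ → subst (λ d → ℚ.∣ d ∣ ℚ.< ε) (sym (ℚ.+-inverseʳ q)) 0<ε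

  +-cauchy : ∀ {x y} → Cauchy x → Cauchy y → Cauchy (λ n → x n ℚ.+ y n)
  +-cauchy {x} {y} cx cy ε 0<ε
    with M , hx ← cx (½ ℚ.* ε) (½-pos 0<ε)
       | N , hy ← cy (½ ℚ.* ε) (½-pos 0<ε)
    = M ℕ.⊔ N , λ m n l r → begin-strict
      ℚ.∣ (x m ℚ.+ y m) ℚ.- (x n ℚ.+ y n) ∣
        ≡⟨ cong ℚ.∣_∣ (regroup (x m) (y m) (x n) (y n)) ⟩
      ℚ.∣ (x m ℚ.- x n) ℚ.+ (y m ℚ.- y n) ∣
        ≤⟨ ℚ.∣p+q∣≤∣p∣+∣q∣ (x m ℚ.- x n) (y m ℚ.- y n) ⟩
      ℚ.∣ x m ℚ.- x n ∣ ℚ.+ ℚ.∣ y m ℚ.- y n ∣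
        <⟨ ℚ.+-mono-< (hx m n (ℕ.m⊔n≤o⇒m≤o M N l) (ℕ.m⊔n≤o⇒m≤o M N r))
                      (hy m n (ℕ.m⊔n≤o⇒n≤o M N l) (ℕ.m⊔n≤o⇒n≤o M N r)) ⟩
      ½ ℚ.* ε ℚ.+ ½ ℚ.* ε
        ≡⟨ halves ε ⟩
      ε ∎
    where
    open ℚ.≤-Reasoning
    regroup : ∀ a b c d → (a ℚ.+ b) ℚ.- (c ℚ.+ d) ≡ (a ℚ.- c) ℚ.+ (b ℚ.- d)
    regroup = solve 4 (λ a b c d → (a :+ b) :- (c :+ d) := (a :- c) :+ (b :- d)) refl
      where open +-*-Solver

  neg-cauchy : ∀ {x} → Cauchy x → Cauchy (λ n → ℚ.- x n)
  neg-cauchy {x} cx ε 0<ε with N , hx ← cx ε 0<ε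
    = N , λ m n l r → subst (ℚ._< ε)
        (trans (sym (ℚ.∣-p∣≡∣p∣ (x m ℚ.- x n))) (cong ℚ.∣_∣ (ℚ.neg-distrib-+ (x m) (ℚ.- x n))))
        (hx m n l r)

  eventually-bounded : ∀ {x} → Cauchy x →
    ∃ λ B → 0ℚ ℚ.< B × ∃ λ N → ∀ n → N ℕ.≤ n → ℚ.∣ x n ∣ ℚ.≤ B
  eventually-bounded {x} cx with N , hx ← cx 1ℚ (ℚ.positive⁻¹ 1ℚ)
    = 1ℚ ℚ.+ ℚ.∣ x N ∣
    , ℚ.+-mono-<-≤ (ℚ.positive⁻¹ 1ℚ) (ℚ.0≤∣p∣ (x N))
    , N
    , λ n l → begin
      ℚ.∣ x n ∣                       ≡⟨ cong ℚ.∣_∣ (split (x n) (x N)) ⟩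
      ℚ.∣ (x n ℚ.- x N) ℚ.+ x N ∣     ≤⟨ ℚ.∣p+q∣≤∣p∣+∣q∣ (x n ℚ.- x N) (x N) ⟩
      ℚ.∣ x n ℚ.- x N ∣ ℚ.+ ℚ.∣ x N ∣ ≤⟨ ℚ.+-monoˡ-≤ ℚ.∣ x N ∣ (ℚ.<⇒≤ (hx n N l ℕ.≤-refl)) ⟩
      1ℚ ℚ.+ ℚ.∣ x N ∣                ∎
    where
    open ℚ.≤-Reasoning
    split : ∀ a b → a ≡ (a ℚ.- b) ℚ.+ b
    split = solve 2 (λ a b → a := (a :- b) :+ b) refl
      where open +-*-Solver

  shrink : ∀ {B ε} → 0ℚ ℚ.< B → 0ℚ ℚ.< ε → ∃ λ δ → 0ℚ ℚ.< δ × B ℚ.* δ ≡ ε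
  shrink {B} {ε} 0<B 0<ε = δ
    , subst (ℚ._< δ) (ℚ.*-zeroʳ B⁻¹) (ℚ.*-monoʳ-<-pos B⁻¹ {{ℚ.1/pos⇒pos B}} 0<ε)
    , trans (sym (ℚ.*-assoc B B⁻¹ ε))
        (trans (cong (ℚ._* ε) (ℚ.*-inverseʳ B)) (ℚ.*-identityˡ ε))
    where
    instance
      B-pos : ℚ.Positive B
      B-pos = ℚ.positive 0<B
      B≢0 : ℚ.NonZero B
      B≢0 = ℚ.pos⇒nonZero B
    B⁻¹ = ℚ.1/ B
    δ = B⁻¹ ℚ.* ε

  *-bound : ∀ a b {A ε} → 0ℚ ℚ.< A → ℚ.∣ a ∣ ℚ.≤ A →
    (∃ λ δ → A ℚ.* δ ≡ ε × ℚ.∣ b ∣ ℚ.< δ) → ℚ.∣ a ℚ.* b ∣ ℚ.< ε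
  *-bound a b {A} {ε} 0<A a≤A (δ , Aδ≡ε , b<δ) = begin-strict
    ℚ.∣ a ℚ.* b ∣         ≡⟨ ℚ.∣p*q∣≡∣p∣*∣q∣ a b ⟩
    ℚ.∣ a ∣ ℚ.* ℚ.∣ b ∣   ≤⟨ ℚ.*-monoʳ-≤-nonNeg ℚ.∣ b ∣ {{ℚ.∣-∣-nonNeg b}} a≤A ⟩
    A ℚ.* ℚ.∣ b ∣         <⟨ ℚ.*-monoʳ-<-pos A {{ℚ.positive 0<A}} b<δ ⟩
    A ℚ.* δ               ≡⟨ Aδ≡ε ⟩
    ε                     ∎
    where open ℚ.≤-Reasoning

  regroup-* : ∀ a b c d →
    a ℚ.* b ℚ.- c ℚ.* d ≡ a ℚ.* (b ℚ.- d) ℚ.+ d ℚ.* (a ℚ.- c)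
  regroup-* = solve 4 (λ a b c d →
      a :* b :- c :* d := a :* (b :- d) :+ d :* (a :- c)) refl
    where open +-*-Solver

  *-estimate : ∀ a b c d {ε} →
    ℚ.∣ a ℚ.* (b ℚ.- d) ∣ ℚ.< ½ ℚ.* ε → ℚ.∣ d ℚ.* (a ℚ.- c) ∣ ℚ.< ½ ℚ.* ε →
    ℚ.∣ a ℚ.* b ℚ.- c ℚ.* d ∣ ℚ.< ε
  *-estimate a b c d {ε} h₁ h₂ = begin-strict
    ℚ.∣ a ℚ.* b ℚ.- c ℚ.* d ∣
      ≡⟨ cong ℚ.∣_∣ (regroup-* a b c d) ⟩
    ℚ.∣ a ℚ.* (b ℚ.- d) ℚ.+ d ℚ.* (a ℚ.- c) ∣
      ≤⟨ ℚ.∣p+q∣≤∣p∣+∣q∣ (a ℚ.* (b ℚ.- d)) (d ℚ.* (a ℚ.- c)) ⟩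
    ℚ.∣ a ℚ.* (b ℚ.- d) ∣ ℚ.+ ℚ.∣ d ℚ.* (a ℚ.- c) ∣
      <⟨ ℚ.+-mono-< h₁ h₂ ⟩
    ½ ℚ.* ε ℚ.+ ½ ℚ.* ε
      ≡⟨ halves ε ⟩
    ε ∎
    where open ℚ.≤-Reasoning

  EventuallyBoundedBy : ℚ → (ℕ → ℚ) → Set
  EventuallyBoundedBy B x = ∃ λ N → ∀ n → N ℕ.≤ n → ℚ.∣ x n ∣ ℚ.≤ B

  *-small : ∀ {x z : ℕ → ℚ} {A} → 0ℚ ℚ.< A → EventuallyBoundedBy A x → Cauchy z →
    ∀ ε → 0ℚ ℚ.< ε → ∃ λ N → ∀ i m n → N ℕ.≤ i → N ℕ.≤ m → N ℕ.≤ n →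
    ℚ.∣ x i ℚ.* (z m ℚ.- z n) ∣ ℚ.< ε
  *-small {x} {z} {A} 0<A (K , bx) cz ε 0<ε =
    let δ , 0<δ , Aδ≡ε = shrink 0<A 0<ε
        M , hz         = cz δ 0<δ
    in K ℕ.⊔ M , λ i m n li lm ln →
       *-bound (x i) (z m ℚ.- z n) 0<A (bx i (ℕ.m⊔n≤o⇒m≤o K M li))
         (δ , Aδ≡ε , hz m n (ℕ.m⊔n≤o⇒n≤o K M lm) (ℕ.m⊔n≤o⇒n≤o K M ln))

  *-cauchy : ∀ {x y} → Cauchy x → Cauchy y → Cauchy (λ n → x n ℚ.* y n)
  *-cauchy {x} {y} cx cy ε 0<ε =
    let A , 0<A , bx = eventually-bounded cx
        B , 0<B , by = eventually-bounded cy
        M , hx = *-small {x} {y} 0<A bx cy (½ ℚ.* ε) (½-pos 0<ε)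
        N , hy = *-small {y} {x} 0<B by cx (½ ℚ.* ε) (½-pos 0<ε)
    in M ℕ.⊔ N , λ m n l r →
       *-estimate (x m) (y m) (x n) (y n)
         (hx m m n (ℕ.m⊔n≤o⇒m≤o M N l) (ℕ.m⊔n≤o⇒m≤o M N l) (ℕ.m⊔n≤o⇒m≤o M N r))
         (hy n m n (ℕ.m⊔n≤o⇒n≤o M N r) (ℕ.m⊔n≤o⇒n≤o M N l) (ℕ.m⊔n≤o⇒n≤o M N r))

infixl 6 _+_ _-_
infixl 7 _*_ _/2
infix  8 -_
infix  4 _≤_ _≥_

fromℚ : ℚ → ℝ
fromℚ q = mkℝ (λ _ → q) (const-cauchy q)

0ℝ 1ℝ : ℝ
0ℝ = fromℚ 0ℚ
1ℝ = fromℚ 1ℚ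

_+_ _*_ : ℝ → ℝ → ℝ
x + y = mkℝ (λ n → seq x n ℚ.+ seq y n) (+-cauchy {seq x} {seq y} (cauchy x) (cauchy y))
x * y = mkℝ (λ n → seq x n ℚ.* seq y n) (*-cauchy {seq x} {seq y} (cauchy x) (cauchy y))

-_ : ℝ → ℝ
- x = mkℝ (λ n → ℚ.- seq x n) (neg-cauchy {seq x} (cauchy x))

_-_ : ℝ → ℝ → ℝ
x - y = x + (- y)

-- The slack ε is needed: limits, not terms, are being compared.
_≤_ _≥_ : ℝ → ℝ → Set
x ≤ y = ∀ ε → 0ℚ ℚ.< ε → ∃ λ N → ∀ n → N ℕ.≤ n → seq x n ℚ.≤ seq y n ℚ.+ ε
x ≥ y = y ≤ x

_/2 : ℝ → ℝ
x /2 = x * fromℚ ½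

sum : List ℝ → ℝ
sum = foldr _+_ 0ℝ

-- Families of subsets of an m-element ground set.  A family is a predicate on
-- Subset m; decidability, automatic classically, lets its measure be computed.

Monotone : ∀ {m ℓ} → Pred (Subset m) ℓ → Set ℓ
Monotone 𝒜 = 𝒜 Respects _⊆_

Minterm : ∀ {m ℓ} → Pred (Subset m) ℓ → Pred (Subset m) ℓ
Minterm 𝒜 A = 𝒜 A × (∀ B → 𝒜 B → B ⊆ A → B ≡ A)

subsets : ∀ m → List (Subset m)
subsets zero    = [ [] ]
subsets (suc m) = map (outside ∷_) (subsets m) ++ map (inside ∷_) (subsets m)

-- Pr[S] for the p-random subset: independence makes it a product over the
-- ground set, with factor p for each element in S and 1 - p for each other one.
Pr : ∀ {m} → ℝ → Subset m → ℝ
Pr p []            = 1ℝ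
Pr p (inside  ∷ S) = p * Pr p S
Pr p (outside ∷ S) = (1ℝ - p) * Pr p S

μ : ∀ {m ℓ} {𝒜 : Pred (Subset m) ℓ} → ℝ → Decidable 𝒜 → ℝ
μ {m} p 𝒜? = sum (map (Pr p) (filter 𝒜? (subsets m)))

-- 3k - 1 is not truncated, since k ≥ 1.
constant : ∀ k → .{{NonZero k}} → ℚ
constant k = 1ℤ ℚ./ (k ℕ.* 2 ℕ.^ (3 ℕ.* k ℕ.∸ 1))
  where
  instance
    d≢0 : NonZero (k ℕ.* 2 ℕ.^ (3 ℕ.* k ℕ.∸ 1))
    d≢0 = ℕ.m*n≢0 k _ {{it}} {{ℕ.m^n≢0 2 (3 ℕ.* k ℕ.∸ 1)}}

{-# OPTIONS --safe #-}

-- Halving p amounts to thinning a p-random set S by independent fair coins.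
-- If S belongs to the family it contains a minterm T with at most k elements;
-- T survives the thinning with probability at least 2⁻ᵏ, and then so does
-- membership, by monotonicity.  Hence μ (p/2) ≥ 2⁻ᵏ μ p, and 2ᵏ ≤ k 2³ᵏ⁻¹.
module Submission where

open import Defs
open import Data.Bool.Base using (true; false; if_then_else_)
open import Data.Fin.Subset using (Subset; Side; inside; outside; _⊆_; ∣_∣)
open import Data.Fin.Subset.Properties
  using (s⊆s; out⊆; drop-∷-⊆; ⊆-refl; ⊆-trans)
open import Data.Integer.Base as ℤ using (1ℤ)
open import Data.List.Base using (List; []; _∷_; [_]; _++_; map; filter)
open import Data.List.Properties using (map-++; filter-++)
open import Data.Nat.Base as ℕ using (ℕ; zero; suc; NonZero)
import Data.Nat.Properties as ℕ
open import Data.Product.Base using (∃; _×_; _,_)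
open import Data.Rational.Base as ℚ using (ℚ; 0ℚ; 1ℚ; ½)
import Data.Rational.Properties as ℚ
open import Data.Rational.Solver using (module +-*-Solver)
open import Data.Rational.Unnormalised.Base as ℚᵘ using (*≡*; *≤*)
import Data.Rational.Unnormalised.Properties as ℚᵘ
open import Data.Sum.Base using (inj₁; inj₂)
open import Data.Vec.Base using ([]; _∷_; here)
open import Function.Base using (_∘_; it)
open import Level using (Level)
open import Relation.Binary.PropositionalEquality
  using (_≡_; refl; sym; trans; cong; cong₂; subst; subst₂)
open import Relation.Nullary using (does; yes; no; contradiction)
open import Relation.Unary using (Pred; Decidable)

private
  variable
    ℓ : Level
    m : ℕ

-- Rational inequalities

0≤p+q : ∀ {p q} → 0ℚ ℚ.≤ p → 0ℚ ℚ.≤ q → 0ℚ ℚ.≤ p ℚ.+ q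
0≤p+q = ℚ.+-mono-≤

0≤p*q : ∀ {p q} → 0ℚ ℚ.≤ p → 0ℚ ℚ.≤ q → 0ℚ ℚ.≤ p ℚ.* q
0≤p*q {p} {q} 0≤p 0≤q = ℚ.nonNegative⁻¹ (p ℚ.* q)
  {{ℚ.nonNeg*nonNeg⇒nonNeg p {{ℚ.nonNegative 0≤p}} q {{ℚ.nonNegative 0≤q}}}}

p≤q⇒0≤q-p : ∀ {p q} → p ℚ.≤ q → 0ℚ ℚ.≤ q ℚ.- p
p≤q⇒0≤q-p {p} {q} p≤q =
  subst (ℚ._≤ q ℚ.- p) (ℚ.+-inverseʳ p) (ℚ.+-monoˡ-≤ (ℚ.- p) p≤q)

0≤q-p⇒p≤q : ∀ {p q} → 0ℚ ℚ.≤ q ℚ.- p → p ℚ.≤ q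
0≤q-p⇒p≤q {p} {q} 0≤q-p =
  subst₂ ℚ._≤_ (ℚ.+-identityˡ p) (cancel p q) (ℚ.+-monoˡ-≤ p 0≤q-p)
  where
  cancel : ∀ p q → (q ℚ.- p) ℚ.+ p ≡ q
  cancel = solve 2 (λ p q → (q :- p) :+ p := q) refl
    where open +-*-Solver

p≤∣p∣ : ∀ p → p ℚ.≤ ℚ.∣ p ∣
p≤∣p∣ p with ℚ.≤-total 0ℚ p
... | inj₁ 0≤p = ℚ.≤-reflexive (sym (ℚ.0≤p⇒∣p∣≡p 0≤p))
... | inj₂ p≤0 = ℚ.≤-trans p≤0 (ℚ.0≤∣p∣ p)

solve-*≡ : ∀ {A ε} → 0ℚ ℚ.< A → 0ℚ ℚ.< ε → ∃ λ δ → 0ℚ ℚ.< δ × A ℚ.* δ ≡ ε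
solve-*≡ {A} {ε} 0<A 0<ε = A⁻¹ ℚ.* ε
  , subst (ℚ._< A⁻¹ ℚ.* ε) (ℚ.*-zeroʳ A⁻¹) (ℚ.*-monoʳ-<-pos A⁻¹ {{ℚ.1/pos⇒pos A}} 0<ε)
  , trans (sym (ℚ.*-assoc A A⁻¹ ε))
      (trans (cong (ℚ._* ε) (ℚ.*-inverseʳ A)) (ℚ.*-identityˡ ε))
  where
  instance
    A-pos : ℚ.Positive A
    A-pos = ℚ.positive 0<A
    A≢0 : ℚ.NonZero A
    A≢0 = ℚ.pos⇒nonZero A
  A⁻¹ = ℚ.1/ A

-- Nonnegative reals

bounded-above : ∀ x → ∃ λ B → 0ℚ ℚ.< B × ∃ λ N → ∀ n → N ℕ.≤ n → seq x n ℚ.≤ B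
bounded-above x with N , close ← cauchy x 1ℚ (ℚ.positive⁻¹ 1ℚ)
  = 1ℚ ℚ.+ ℚ.∣ seq x N ∣
  , ℚ.+-mono-<-≤ (ℚ.positive⁻¹ 1ℚ) (ℚ.0≤∣p∣ (seq x N))
  , N
  , λ n N≤n → begin
    seq x n                               ≡⟨ split (seq x n) (seq x N) ⟩
    (seq x n ℚ.- seq x N) ℚ.+ seq x N
      ≤⟨ ℚ.+-mono-≤ (ℚ.≤-trans (p≤∣p∣ _) (ℚ.<⇒≤ (close n N N≤n ℕ.≤-refl))) (p≤∣p∣ _) ⟩
    1ℚ ℚ.+ ℚ.∣ seq x N ∣                  ∎
  where
  open ℚ.≤-Reasoning
  split : ∀ a b → a ≡ (a ℚ.- b) ℚ.+ b
  split = solve 2 (λ a b → a := (a :- b) :+ b) refl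
    where open +-*-Solver

private
  half-pos : ∀ {ε} → 0ℚ ℚ.< ε → 0ℚ ℚ.< ½ ℚ.* ε
  half-pos = ℚ.*-monoʳ-<-pos ½

  halves : ∀ ε → ½ ℚ.* ε ℚ.+ ½ ℚ.* ε ≡ ε
  halves = solve 1 (λ e → con ½ :* e :+ con ½ :* e := e) refl
    where open +-*-Solver

fromℚ-nonNeg : ∀ {q} → 0ℚ ℚ.≤ q → 0ℝ ≤ fromℚ q
fromℚ-nonNeg 0≤q ε 0<ε = 0 , λ _ _ → 0≤p+q 0≤q (ℚ.<⇒≤ 0<ε)

+-nonNeg : ∀ x y → 0ℝ ≤ x → 0ℝ ≤ y → 0ℝ ≤ x + y
+-nonNeg x y 0≤x 0≤y ε 0<ε
  with M , hx ← 0≤x (½ ℚ.* ε) (half-pos 0<ε)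
     | N , hy ← 0≤y (½ ℚ.* ε) (half-pos 0<ε)
  = M ℕ.⊔ N , λ n l → subst (0ℚ ℚ.≤_)
      (trans (regroup (seq x n) (seq y n) (½ ℚ.* ε))
        (cong (seq x n ℚ.+ seq y n ℚ.+_) (halves ε)))
      (0≤p+q (hx n (ℕ.m⊔n≤o⇒m≤o M N l)) (hy n (ℕ.m⊔n≤o⇒n≤o M N l)))
  where
  regroup : ∀ a b h → (a ℚ.+ h) ℚ.+ (b ℚ.+ h) ≡ (a ℚ.+ b) ℚ.+ (h ℚ.+ h)
  regroup = solve 3 (λ a b h → (a :+ h) :+ (b :+ h) := (a :+ b) :+ (h :+ h)) refl
    where open +-*-Solver

-- With x ≤ A, y ≤ B, x ≥ -δ, y ≥ -η and (A + δ)η + Bδ = ε, the quantity xy + ε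
-- is the sum of the nonnegative terms (x + δ)(y + η), (A - x)η and (B - y)δ.
*-nonNeg : ∀ x y → 0ℝ ≤ x → 0ℝ ≤ y → 0ℝ ≤ x * y
*-nonNeg x y 0≤x 0≤y ε 0<ε =
  let A , 0<A , M₁ , x≤A = bounded-above x
      B , 0<B , M₂ , y≤B = bounded-above y
      δ , 0<δ , Bδ≡      = solve-*≡ 0<B (half-pos 0<ε)
      η , 0<η , A+δη≡    = solve-*≡ (ℚ.+-mono-< 0<A 0<δ) (half-pos 0<ε)
      N₁ , -δ≤x          = 0≤x δ 0<δ
      N₂ , -η≤y          = 0≤y η 0<η
      M = M₁ ℕ.⊔ M₂
      N = N₁ ℕ.⊔ N₂
  in M ℕ.⊔ N , λ n l →
     let l₁ = ℕ.m⊔n≤o⇒m≤o M N l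
         l₂ = ℕ.m⊔n≤o⇒n≤o M N l
     in subst (0ℚ ℚ.≤_)
          (trans (sym (expand (seq x n) (seq y n) A B δ η))
            (cong (seq x n ℚ.* seq y n ℚ.+_) (trans (cong₂ ℚ._+_ A+δη≡ Bδ≡) (halves ε))))
          (0≤p+q
            (0≤p+q
              (0≤p*q (-δ≤x n (ℕ.m⊔n≤o⇒m≤o N₁ N₂ l₂)) (-η≤y n (ℕ.m⊔n≤o⇒n≤o N₁ N₂ l₂)))
              (0≤p*q (p≤q⇒0≤q-p (x≤A n (ℕ.m⊔n≤o⇒m≤o M₁ M₂ l₁))) (ℚ.<⇒≤ 0<η)))
            (0≤p*q (p≤q⇒0≤q-p (y≤B n (ℕ.m⊔n≤o⇒n≤o M₁ M₂ l₁))) (ℚ.<⇒≤ 0<δ)))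
  where
  expand : ∀ x y A B δ η →
    x ℚ.* y ℚ.+ ((A ℚ.+ δ) ℚ.* η ℚ.+ B ℚ.* δ) ≡
    (x ℚ.+ δ) ℚ.* (y ℚ.+ η) ℚ.+ (A ℚ.- x) ℚ.* η ℚ.+ (B ℚ.- y) ℚ.* δ
  expand = solve 6 (λ x y A B δ η →
      x :* y :+ ((A :+ δ) :* η :+ B :* δ) :=
      (x :+ δ) :* (y :+ η) :+ (A :- x) :* η :+ (B :- y) :* δ) refl
    where open +-*-Solver

≤⇒0≤- : ∀ x y → x ≤ y → 0ℝ ≤ y - x
≤⇒0≤- x y x≤y ε 0<ε with N , h ← x≤y ε 0<ε
  = N , λ n l → subst (0ℚ ℚ.≤_) (swap (seq x n) (seq y n) ε) (p≤q⇒0≤q-p (h n l))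
  where
  swap : ∀ a b e → (b ℚ.+ e) ℚ.- a ≡ (b ℚ.- a) ℚ.+ e
  swap = solve 3 (λ a b e → (b :+ e) :- a := (b :- a) :+ e) refl
    where open +-*-Solver

-- Expectation over the p-random subset

𝔼 : ℝ → (Subset m → ℚ) → ℝ
𝔼 {zero}  p f = fromℚ (f [])
𝔼 {suc m} p f = (1ℝ - p) * 𝔼 p (f ∘ (outside ∷_)) + p * 𝔼 p (f ∘ (inside ∷_))

𝔼-nonNeg : ∀ p → 0ℝ ≤ p → p ≤ 1ℝ → (f : Subset m → ℚ) → (∀ S → 0ℚ ℚ.≤ f S) → 0ℝ ≤ 𝔼 p f
𝔼-nonNeg {zero}  p 0≤p p≤1 f 0≤f = fromℚ-nonNeg (0≤f [])
𝔼-nonNeg {suc m} p 0≤p p≤1 f 0≤f = +-nonNeg ((1ℝ - p) * E₀) (p * E₁)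
  (*-nonNeg (1ℝ - p) E₀ (≤⇒0≤- p 1ℝ p≤1)
    (𝔼-nonNeg p 0≤p p≤1 (f ∘ (outside ∷_)) (0≤f ∘ (outside ∷_))))
  (*-nonNeg p E₁ 0≤p
    (𝔼-nonNeg p 0≤p p≤1 (f ∘ (inside ∷_)) (0≤f ∘ (inside ∷_))))
  where
  E₀ = 𝔼 p (f ∘ (outside ∷_))
  E₁ = 𝔼 p (f ∘ (inside ∷_))

𝔼-linear : ∀ p a b (f g : Subset m → ℚ) i →
  seq (𝔼 p (λ S → a ℚ.* f S ℚ.+ b ℚ.* g S)) i ≡ a ℚ.* seq (𝔼 p f) i ℚ.+ b ℚ.* seq (𝔼 p g) i
𝔼-linear {zero}  p a b f g i = refl
𝔼-linear {suc m} p a b f g i = trans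
  (cong₂ (λ u v → (1ℚ ℚ.- seq p i) ℚ.* u ℚ.+ seq p i ℚ.* v)
    (𝔼-linear p a b (f ∘ (outside ∷_)) (g ∘ (outside ∷_)) i)
    (𝔼-linear p a b (f ∘ (inside ∷_)) (g ∘ (inside ∷_)) i))
  (regroup (seq p i) a b _ _ _ _)
  where
  regroup : ∀ p a b f₀ f₁ g₀ g₁ →
    (1ℚ ℚ.- p) ℚ.* (a ℚ.* f₀ ℚ.+ b ℚ.* g₀) ℚ.+ p ℚ.* (a ℚ.* f₁ ℚ.+ b ℚ.* g₁) ≡
    a ℚ.* ((1ℚ ℚ.- p) ℚ.* f₀ ℚ.+ p ℚ.* f₁) ℚ.+ b ℚ.* ((1ℚ ℚ.- p) ℚ.* g₀ ℚ.+ p ℚ.* g₁)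
  regroup = solve 7 (λ p a b f₀ f₁ g₀ g₁ →
      (con 1ℚ :- p) :* (a :* f₀ :+ b :* g₀) :+ p :* (a :* f₁ :+ b :* g₁) :=
      a :* ((con 1ℚ :- p) :* f₀ :+ p :* f₁) :+ b :* ((con 1ℚ :- p) :* g₀ :+ p :* g₁)) refl
    where open +-*-Solver

-- thin f S is the average of f over the subsets of S.
thin : (Subset m → ℚ) → Subset m → ℚ
thin f []            = f []
thin f (outside ∷ S) = thin (f ∘ (outside ∷_)) S
thin f (inside  ∷ S) = ½ ℚ.* thin (f ∘ (outside ∷_)) S ℚ.+ ½ ℚ.* thin (f ∘ (inside ∷_)) S

𝔼-/2 : ∀ p (f : Subset m → ℚ) i → seq (𝔼 (p /2) f) i ≡ seq (𝔼 p (thin f)) i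
𝔼-/2 {zero}  p f i = refl
𝔼-/2 {suc m} p f i = trans
  (cong₂ (λ u v → (1ℚ ℚ.- seq p i ℚ.* ½) ℚ.* u ℚ.+ (seq p i ℚ.* ½) ℚ.* v)
    (𝔼-/2 p f₀ i) (𝔼-/2 p f₁ i))
  (trans (regroup (seq p i) (seq (𝔼 p (thin f₀)) i) (seq (𝔼 p (thin f₁)) i))
    (cong (λ u → (1ℚ ℚ.- seq p i) ℚ.* seq (𝔼 p (thin f₀)) i ℚ.+ seq p i ℚ.* u)
      (sym (𝔼-linear p ½ ½ (thin f₀) (thin f₁) i))))
  where
  f₀ = f ∘ (outside ∷_)
  f₁ = f ∘ (inside ∷_)
  regroup : ∀ p u v →
    (1ℚ ℚ.- p ℚ.* ½) ℚ.* u ℚ.+ (p ℚ.* ½) ℚ.* v ≡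
    (1ℚ ℚ.- p) ℚ.* u ℚ.+ p ℚ.* (½ ℚ.* u ℚ.+ ½ ℚ.* v)
  regroup = solve 3 (λ p u v →
      (con 1ℚ :- p :* con ½) :* u :+ (p :* con ½) :* v :=
      (con 1ℚ :- p) :* u :+ p :* (con ½ :* u :+ con ½ :* v)) refl
    where open +-*-Solver

-- The measure as the expectation of an indicator

𝟙 : {𝒜 : Pred (Subset m) ℓ} → Decidable 𝒜 → Subset m → ℚ
𝟙 𝒜? S = if does (𝒜? S) then 1ℚ else 0ℚ

𝟙-nonNeg : {𝒜 : Pred (Subset m) ℓ} (𝒜? : Decidable 𝒜) → ∀ S → 0ℚ ℚ.≤ 𝟙 𝒜? S
𝟙-nonNeg 𝒜? S with does (𝒜? S)
... | true  = ℚ.nonNegative⁻¹ 1ℚ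
... | false = ℚ.≤-refl

factor : ℝ → Side → ℝ
factor p inside  = p
factor p outside = 1ℝ - p

Pr-∷ : ∀ p s (S : Subset m) i → seq (Pr p (s ∷ S)) i ≡ seq (factor p s) i ℚ.* seq (Pr p S) i
Pr-∷ p inside  S i = refl
Pr-∷ p outside S i = refl

sum-++ : ∀ xs ys i → seq (sum (xs ++ ys)) i ≡ seq (sum xs) i ℚ.+ seq (sum ys) i
sum-++ []       ys i = sym (ℚ.+-identityˡ _)
sum-++ (x ∷ xs) ys i =
  trans (cong (seq x i ℚ.+_) (sum-++ xs ys i)) (sym (ℚ.+-assoc (seq x i) _ _))

measure : ℝ → {𝒜 : Pred (Subset m) ℓ} → Decidable 𝒜 → List (Subset m) → ℝ
measure p 𝒜? Ss = sum (map (Pr p) (filter 𝒜? Ss))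

measure-++ : ∀ p {𝒜 : Pred (Subset m) ℓ} (𝒜? : Decidable 𝒜) Ss Ts i →
  seq (measure p 𝒜? (Ss ++ Ts)) i ≡ seq (measure p 𝒜? Ss) i ℚ.+ seq (measure p 𝒜? Ts) i
measure-++ p 𝒜? Ss Ts i = trans
  (cong (λ xs → seq (sum xs) i) (trans (cong (map (Pr p)) (filter-++ 𝒜? Ss Ts))
    (map-++ (Pr p) (filter 𝒜? Ss) (filter 𝒜? Ts))))
  (sum-++ (map (Pr p) (filter 𝒜? Ss)) (map (Pr p) (filter 𝒜? Ts)) i)

filter-map : ∀ {a b} {A : Set a} {B : Set b} {P : Pred B ℓ} (P? : Decidable P) (f : A → B) xs →
  filter P? (map f xs) ≡ map f (filter (P? ∘ f) xs)
filter-map P? f []       = refl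
filter-map P? f (x ∷ xs) with does (P? (f x))
... | false = filter-map P? f xs
... | true  = cong (f x ∷_) (filter-map P? f xs)

sum-Pr-∷ : ∀ p s (Ss : List (Subset m)) i →
  seq (sum (map (Pr p) (map (s ∷_) Ss))) i ≡ seq (factor p s) i ℚ.* seq (sum (map (Pr p) Ss)) i
sum-Pr-∷ p s []       i = sym (ℚ.*-zeroʳ (seq (factor p s) i))
sum-Pr-∷ p s (S ∷ Ss) i = trans (cong₂ ℚ._+_ (Pr-∷ p s S i) (sum-Pr-∷ p s Ss i))
  (sym (ℚ.*-distribˡ-+ (seq (factor p s) i) (seq (Pr p S) i) (seq (sum (map (Pr p) Ss)) i)))

measure-∷ : ∀ p {𝒜 : Pred (Subset (suc m)) ℓ} (𝒜? : Decidable 𝒜) s Ss i →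
  seq (measure p 𝒜? (map (s ∷_) Ss)) i ≡
  seq (factor p s) i ℚ.* seq (measure p (𝒜? ∘ (s ∷_)) Ss) i
measure-∷ p 𝒜? s Ss i = trans
  (cong (λ Ts → seq (sum (map (Pr p) Ts)) i) (filter-map 𝒜? (s ∷_) Ss))
  (sum-Pr-∷ p s (filter (𝒜? ∘ (s ∷_)) Ss) i)

filter-[_] : ∀ {a} {A : Set a} {P : Pred A ℓ} (P? : Decidable P) x →
  filter P? [ x ] ≡ (if does (P? x) then [ x ] else [])
filter-[ P? ] x with does (P? x)
... | true  = refl
... | false = refl

μ≡𝔼𝟙 : ∀ p {𝒜 : Pred (Subset m) ℓ} (𝒜? : Decidable 𝒜) i → seq (μ p 𝒜?) i ≡ seq (𝔼 p (𝟙 𝒜?)) i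
μ≡𝔼𝟙 {zero} p 𝒜? i = trans
  (cong (λ Ss → seq (sum (map (Pr p) Ss)) i) (filter-[ 𝒜? ] []))
  (by-cases (does (𝒜? [])))
  where
  by-cases : ∀ b → seq (sum (map (Pr p) (if b then [ [] ] else []))) i ≡ (if b then 1ℚ else 0ℚ)
  by-cases true  = refl
  by-cases false = refl
μ≡𝔼𝟙 {suc m} p 𝒜? i = trans
  (measure-++ p 𝒜? (map (outside ∷_) (subsets m)) (map (inside ∷_) (subsets m)) i)
  (cong₂ ℚ._+_ (section outside) (section inside))
  where
  section : ∀ s → seq (measure p 𝒜? (map (s ∷_) (subsets m))) i ≡
    seq (factor p s) i ℚ.* seq (𝔼 p (𝟙 (𝒜? ∘ (s ∷_)))) i
  section s = trans (measure-∷ p 𝒜? s (subsets m) i)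
    (cong (seq (factor p s) i ℚ.*_) (μ≡𝔼𝟙 p (𝒜? ∘ (s ∷_)) i))

-- Minterms survive thinning

½^_ : ℕ → ℚ
½^ zero  = 1ℚ
½^ suc k = ½ ℚ.* ½^ k

½^-nonNeg : ∀ k → 0ℚ ℚ.≤ ½^ k
½^-nonNeg zero    = ℚ.nonNegative⁻¹ 1ℚ
½^-nonNeg (suc k) = 0≤p*q (ℚ.nonNegative⁻¹ ½) (½^-nonNeg k)

minterm-below : {𝒜 : Pred (Subset m) ℓ} → Decidable 𝒜 → Monotone 𝒜 →
  ∀ S → 𝒜 S → ∃ λ T → Minterm 𝒜 T × T ⊆ S
minterm-below 𝒜? mono [] S∈𝒜 = [] , (S∈𝒜 , λ { [] _ _ → refl }) , ⊆-refl
minterm-below {𝒜 = 𝒜} 𝒜? mono (s ∷ S) S∈𝒜 with 𝒜? (outside ∷ S)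
... | yes out∈𝒜
  with T , (T∈𝒜 , T-min) , T⊆S
       ← minterm-below (𝒜? ∘ (outside ∷_)) (mono ∘ s⊆s) S out∈𝒜
  = outside ∷ T , (T∈𝒜 , minimal) , out⊆ T⊆S
  where
  minimal : ∀ B → 𝒜 B → B ⊆ outside ∷ T → B ≡ outside ∷ T
  minimal (outside ∷ B) B∈𝒜 B⊆T = cong (outside ∷_) (T-min B B∈𝒜 (drop-∷-⊆ B⊆T))
  minimal (inside  ∷ B) B∈𝒜 B⊆T = contradiction (B⊆T here) λ ()
minterm-below {𝒜 = 𝒜} 𝒜? mono (outside ∷ S) S∈𝒜 | no out∉𝒜 = contradiction S∈𝒜 out∉𝒜
minterm-below {𝒜 = 𝒜} 𝒜? mono (inside  ∷ S) S∈𝒜 | no out∉𝒜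
  with T , (T∈𝒜 , T-min) , T⊆S
       ← minterm-below (𝒜? ∘ (inside ∷_)) (mono ∘ s⊆s) S S∈𝒜
  = inside ∷ T , (T∈𝒜 , minimal) , s⊆s T⊆S
  where
  minimal : ∀ B → 𝒜 B → B ⊆ inside ∷ T → B ≡ inside ∷ T
  minimal (inside  ∷ B) B∈𝒜 B⊆T = cong (inside ∷_) (T-min B B∈𝒜 (drop-∷-⊆ B⊆T))
  minimal (outside ∷ B) B∈𝒜 B⊆T =
    contradiction (mono (s⊆s (⊆-trans (drop-∷-⊆ B⊆T) T⊆S)) B∈𝒜) out∉𝒜

thin-nonNeg : (f : Subset m → ℚ) → (∀ S → 0ℚ ℚ.≤ f S) → ∀ S → 0ℚ ℚ.≤ thin f S
thin-nonNeg f 0≤f []            = 0≤f []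
thin-nonNeg f 0≤f (outside ∷ S) = thin-nonNeg (f ∘ (outside ∷_)) (0≤f ∘ (outside ∷_)) S
thin-nonNeg f 0≤f (inside  ∷ S) = 0≤p+q
  (0≤p*q (ℚ.nonNegative⁻¹ ½) (thin-nonNeg (f ∘ (outside ∷_)) (0≤f ∘ (outside ∷_)) S))
  (0≤p*q (ℚ.nonNegative⁻¹ ½) (thin-nonNeg (f ∘ (inside ∷_)) (0≤f ∘ (inside ∷_)) S))

½^∣T∣≤thin : {𝒜 : Pred (Subset m) ℓ} (𝒜? : Decidable 𝒜) → Monotone 𝒜 →
  ∀ S T → 𝒜 T → T ⊆ S → ½^ ∣ T ∣ ℚ.≤ thin (𝟙 𝒜?) S
½^∣T∣≤thin 𝒜? mono [] [] T∈𝒜 T⊆S with 𝒜? []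
... | yes _   = ℚ.≤-refl
... | no  T∉𝒜 = contradiction T∈𝒜 T∉𝒜
½^∣T∣≤thin 𝒜? mono (outside ∷ S) (outside ∷ T) T∈𝒜 T⊆S =
  ½^∣T∣≤thin (𝒜? ∘ (outside ∷_)) (mono ∘ s⊆s) S T T∈𝒜 (drop-∷-⊆ T⊆S)
½^∣T∣≤thin 𝒜? mono (outside ∷ S) (inside ∷ T) T∈𝒜 T⊆S = contradiction (T⊆S here) λ ()
½^∣T∣≤thin 𝒜? mono (inside ∷ S) (outside ∷ T) T∈𝒜 T⊆S =
  subst (ℚ._≤ _) (halves (½^ ∣ T ∣))
    (ℚ.+-mono-≤
      (ℚ.*-monoˡ-≤-nonNeg ½
        (½^∣T∣≤thin (𝒜? ∘ (outside ∷_)) (mono ∘ s⊆s) S T T∈𝒜 (drop-∷-⊆ T⊆S)))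
      (ℚ.*-monoˡ-≤-nonNeg ½
        (½^∣T∣≤thin (𝒜? ∘ (inside ∷_)) (mono ∘ s⊆s) S T (mono (out⊆ ⊆-refl) T∈𝒜) (drop-∷-⊆ T⊆S))))
½^∣T∣≤thin 𝒜? mono (inside ∷ S) (inside ∷ T) T∈𝒜 T⊆S =
  subst (ℚ._≤ _) (ℚ.+-identityˡ (½ ℚ.* ½^ ∣ T ∣))
    (ℚ.+-mono-≤
      (0≤p*q (ℚ.nonNegative⁻¹ ½)
        (thin-nonNeg (𝟙 (𝒜? ∘ (outside ∷_))) (𝟙-nonNeg (𝒜? ∘ (outside ∷_))) S))
      (ℚ.*-monoˡ-≤-nonNeg ½
        (½^∣T∣≤thin (𝒜? ∘ (inside ∷_)) (mono ∘ s⊆s) S T T∈𝒜 (drop-∷-⊆ T⊆S))))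

-- The constant

½^-antimono : ∀ {j k} → j ℕ.≤ k → ½^ k ℚ.≤ ½^ j
½^-antimono {k = zero}  ℕ.z≤n       = ℚ.≤-refl
½^-antimono {k = suc k} ℕ.z≤n       = ℚ.≤-trans
  (ℚ.*-monoˡ-≤-nonNeg ½ (½^-antimono {k = k} ℕ.z≤n)) (ℚ.≤ᵇ⇒≤ _)
½^-antimono             (ℕ.s≤s j≤k) = ℚ.*-monoˡ-≤-nonNeg ½ (½^-antimono j≤k)

1/-antimono : ∀ d e .{{_ : NonZero d}} .{{_ : NonZero e}} → d ℕ.≤ e → 1ℤ ℚ./ e ℚ.≤ 1ℤ ℚ./ d
1/-antimono d@(suc _) e@(suc _) d≤e = ℚ.toℚᵘ-cancel-≤ (begin
  ℚ.toℚᵘ (1ℤ ℚ./ e)   ≃⟨ ℚ.toℚᵘ-fromℚᵘ (1ℤ ℚᵘ./ e) ⟩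
  1ℤ ℚᵘ./ e           ≤⟨ *≤* (ℤ.+≤+ (ℕ.*-monoʳ-≤ 1 d≤e)) ⟩
  1ℤ ℚᵘ./ d           ≃⟨ ℚ.toℚᵘ-fromℚᵘ (1ℤ ℚᵘ./ d) ⟨
  ℚ.toℚᵘ (1ℤ ℚ./ d)   ∎)
  where open ℚᵘ.≤-Reasoning

½*1/ : ∀ d .{{_ : NonZero d}} → ½ ℚ.* (1ℤ ℚ./ d) ≡ (1ℤ ℚ./ (2 ℕ.* d)) {{ℕ.m*n≢0 2 d}}
½*1/ d@(suc _) = ℚ.toℚᵘ-injective (begin-equality
  ℚ.toℚᵘ (½ ℚ.* (1ℤ ℚ./ d))          ≃⟨ ℚ.toℚᵘ-homo-* ½ (1ℤ ℚ./ d) ⟩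
  ℚ.toℚᵘ ½ ℚᵘ.* ℚ.toℚᵘ (1ℤ ℚ./ d)    ≃⟨ ℚᵘ.*-congˡ {ℚ.toℚᵘ ½} (ℚ.toℚᵘ-fromℚᵘ (1ℤ ℚᵘ./ d)) ⟩
  ℚ.toℚᵘ ½ ℚᵘ.* (1ℤ ℚᵘ./ d)          ≃⟨ *≡* refl ⟩
  1ℤ ℚᵘ./ (2 ℕ.* d)                  ≃⟨ ℚ.toℚᵘ-fromℚᵘ (1ℤ ℚᵘ./ (2 ℕ.* d)) ⟨
  ℚ.toℚᵘ (1ℤ ℚ./ (2 ℕ.* d))          ∎)
  where open ℚᵘ.≤-Reasoning

½^≡1/2^ : ∀ k → ½^ k ≡ (1ℤ ℚ./ (2 ℕ.^ k)) {{ℕ.m^n≢0 2 k}}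
½^≡1/2^ zero    = refl
½^≡1/2^ (suc k) = trans (cong (½ ℚ.*_) (½^≡1/2^ k)) (½*1/ (2 ℕ.^ k) {{ℕ.m^n≢0 2 k}})

k≤3k∸1 : ∀ k → .{{NonZero k}} → k ℕ.≤ 3 ℕ.* k ℕ.∸ 1
k≤3k∸1 (suc k) = ℕ.≤-trans (ℕ.m≤n+m (suc k) k) (ℕ.+-monoʳ-≤ k (ℕ.m≤m+n (suc k) _))

constant≤½^ : ∀ k .{{_ : NonZero k}} → constant k ℚ.≤ ½^ k
constant≤½^ k = subst (constant k ℚ.≤_) (sym (½^≡1/2^ k))
  (1/-antimono (2 ℕ.^ k) (k ℕ.* 2 ℕ.^ (3 ℕ.* k ℕ.∸ 1))
    {{ℕ.m^n≢0 2 k}} {{ℕ.m*n≢0 k _ {{it}} {{ℕ.m^n≢0 2 (3 ℕ.* k ℕ.∸ 1)}}}}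
    (ℕ.≤-trans (ℕ.^-monoʳ-≤ 2 (k≤3k∸1 k)) (ℕ.m≤n*m _ k)))

c𝟙≤thin𝟙 : ∀ k {c} → c ℚ.≤ ½^ k → {𝒜 : Pred (Subset m) ℓ} (𝒜? : Decidable 𝒜) →
  Monotone 𝒜 → (∀ A → Minterm 𝒜 A → ∣ A ∣ ℕ.≤ k) →
  ∀ S → c ℚ.* 𝟙 𝒜? S ℚ.≤ thin (𝟙 𝒜?) S
c𝟙≤thin𝟙 k {c} c≤½^k 𝒜? mono small S with 𝒜? S
... | no _ = ℚ.≤-trans (ℚ.≤-reflexive (ℚ.*-zeroʳ c)) (thin-nonNeg (𝟙 𝒜?) (𝟙-nonNeg 𝒜?) S)
... | yes S∈𝒜 with T , T-minterm@(T∈𝒜 , _) , T⊆S ← minterm-below 𝒜? mono S S∈𝒜 = begin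
  c ℚ.* 1ℚ         ≡⟨ ℚ.*-identityʳ c ⟩
  c                ≤⟨ c≤½^k ⟩
  ½^ k             ≤⟨ ½^-antimono (small T T-minterm) ⟩
  ½^ ∣ T ∣         ≤⟨ ½^∣T∣≤thin 𝒜? mono S T T∈𝒜 T⊆S ⟩
  thin (𝟙 𝒜?) S    ∎
  where open ℚ.≤-Reasoning

corollary4p4 : ∀ {ℓ : Level} (n k : ℕ) .{{_ : NonZero k}}
    (𝒜 : Pred (Subset (suc n)) ℓ) (𝒜? : Decidable 𝒜) →
    Monotone 𝒜 →
    (∀ A → Minterm 𝒜 A → ∣ A ∣ ℕ.≤ k) →
    ∀ (p : ℝ) → 0ℝ ≤ p → p ≤ 1ℝ →
    μ (p /2) 𝒜? ≥ fromℚ (constant k) * μ p 𝒜?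
corollary4p4 n k 𝒜 𝒜? mono small p 0≤p p≤1 ε 0<ε =
  let N , 0≤gap+ε = 𝔼-nonNeg p 0≤p p≤1 gap 0≤gap ε 0<ε
  in N , λ i N≤i → 0≤q-p⇒p≤q (subst (0ℚ ℚ.≤_) (gap-seq i) (0≤gap+ε i N≤i))
  where
  c = constant k

  gap : Subset (suc n) → ℚ
  gap S = 1ℚ ℚ.* thin (𝟙 𝒜?) S ℚ.+ (ℚ.- c) ℚ.* 𝟙 𝒜? S

  rearrange : ∀ c u v e →
    (1ℚ ℚ.* u ℚ.+ (ℚ.- c) ℚ.* v) ℚ.+ e ≡ (u ℚ.+ e) ℚ.- c ℚ.* v
  rearrange = solve 4 (λ c u v e →
      (con 1ℚ :* u :+ (:- c) :* v) :+ e := (u :+ e) :- c :* v) refl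
    where open +-*-Solver

  0≤gap : ∀ S → 0ℚ ℚ.≤ gap S
  0≤gap S = subst (0ℚ ℚ.≤_)
    (cong₂ ℚ._+_ (sym (ℚ.*-identityˡ (thin (𝟙 𝒜?) S))) (ℚ.neg-distribˡ-* c (𝟙 𝒜? S)))
    (p≤q⇒0≤q-p (c𝟙≤thin𝟙 k (constant≤½^ k) 𝒜? mono small S))

  gap-seq : ∀ i → seq (𝔼 p gap) i ℚ.+ ε ≡
    (seq (μ (p /2) 𝒜?) i ℚ.+ ε) ℚ.- c ℚ.* seq (μ p 𝒜?) i
  gap-seq i = trans
    (cong (ℚ._+ ε) (𝔼-linear p 1ℚ (ℚ.- c) (thin (𝟙 𝒜?)) (𝟙 𝒜?) i))
    (trans (rearrange c (seq (𝔼 p (thin (𝟙 𝒜?))) i) (seq (𝔼 p (𝟙 𝒜?)) i) ε)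
      (cong₂ (λ u v → (u ℚ.+ ε) ℚ.- c ℚ.* v)
        (sym (trans (μ≡𝔼𝟙 (p /2) 𝒜? i) (𝔼-/2 p (𝟙 𝒜?) i)))
        (sym (μ≡𝔼𝟙 p 𝒜? i))))
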